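{- Let $n\geq 1$ and let $\{A(x): x\in\mathbb{F}_2^n\}$ be a system of subsets $A(x)\subseteq\mathbb{F}_2^n$ satisfying property $(*)$. If every non-empty $A(x)$ is a linear subspace of $\mathbb{F}_2^n$, then $$\sum_{x\in \mathbb{F}_2^n} |A(x)|\leq 3^n.$$
   Context: For $A\subseteq\mathbb{F}_2^n$ let $A\hat{+}A=\{a+a': a,a'\in A,\ a\neq a'\}$ be the restricted sumset. A system of subsets $A(x)\subseteq \mathbb{F}_2^n$ indexed by $x\in\mathbb{F}_2^n$ satisfies property $(*)$ if for all $x,y\in\mathbb{F}_2^n$: $y\in x+(A(x)\hat{+}A(x))$ implies $A(y)=\emptyset$. (If $A(x)=\emptyset$, then $x+(A(x)\hat{+}A(x))$ is defined to be $\emptyset$.) -}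

module Defs where

open import Data.List.Base using (List; []; _∷_; map; _++_; filter; length; sum)
open import Data.Nat.Base using (ℕ; zero; suc)
open import Data.Parity.Base as ℙ using (Parity; 0ℙ; 1ℙ)
open import Data.Product.Base using (∃; _×_)
import Data.Vec.Base as Vec
open Vec using (Vec)
open import Level using (Level; _⊔_)
open import Relation.Binary.PropositionalEquality using (_≡_; _≢_)
open import Relation.Unary using (Pred; Decidable; _∈_; Empty)

private
  variable
    ℓ ℓ₁ ℓ₂ : Level
    n : ℕ

-- 𝔽₂ is represented by Parity, with its ring operations ℙ._+_ and ℙ._*_.
𝔽₂^ : ℕ → Set
𝔽₂^ n = Vec Parity n

infixl 6 _+_
_+_ : 𝔽₂^ n → 𝔽₂^ n → 𝔽₂^ n
_+_ = Vec.zipWith ℙ._+_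

infixr 7 _·_
_·_ : Parity → 𝔽₂^ n → 𝔽₂^ n
c · v = Vec.map (c ℙ.*_) v

𝟎 : 𝔽₂^ n
𝟎 = Vec.replicate _ 0ℙ

record IsSubspace {n : ℕ} {ℓ : Level} (U : Pred (𝔽₂^ n) ℓ) : Set ℓ where
  field
    𝟎∈       : 𝟎 ∈ U
    +-closed : ∀ {u v} → u ∈ U → v ∈ U → u + v ∈ U
    ·-closed : ∀ c {v} → v ∈ U → c · v ∈ U

infixl 6 _+̂_
_+̂_ : Pred (𝔽₂^ n) ℓ₁ → Pred (𝔽₂^ n) ℓ₂ → Pred (𝔽₂^ n) (ℓ₁ ⊔ ℓ₂)
(A +̂ B) v = ∃ λ a → ∃ λ b → a ∈ A × b ∈ B × a ≢ b × v ≡ a + b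

infixl 5 _+ˢ_
_+ˢ_ : 𝔽₂^ n → Pred (𝔽₂^ n) ℓ → Pred (𝔽₂^ n) ℓ
(x +ˢ B) y = ∃ λ b → b ∈ B × y ≡ x + b

Property* : (𝔽₂^ n → Pred (𝔽₂^ n) ℓ) → Set ℓ
Property* A = ∀ x y → y ∈ x +ˢ (A x +̂ A x) → Empty (A y)

-- Every vector of 𝔽₂ⁿ occurs exactly once in this list.
vectors : ∀ n → List (𝔽₂^ n)
vectors zero    = Vec.[] ∷ []
vectors (suc n) = map (0ℙ Vec.∷_) (vectors n) ++ map (1ℙ Vec.∷_) (vectors n)

-- Subsets whose size is taken come with a decision procedure for membership;
-- classically every subset has one.
card : {P : Pred (𝔽₂^ n) ℓ} → Decidable P → ℕ
card {n = n} P? = length (filter P? (vectors n))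

∑ : (𝔽₂^ n → ℕ) → ℕ
∑ {n} f = sum (map f (vectors n))

{-# OPTIONS --safe #-}

-- Call a function 𝔽₂ⁿ → 𝔽₂ of codegree ≥ d if it is a polynomial of degree ≤ n − d.
-- The indicator of a coset of a subspace of dimension d has codegree ≥ d.  By
-- property (*), the coset x + A(x) contains no other point y with A(y) ≠ ∅, so the
-- indicators of those x + A(x) with dim A(x) ≥ d are linearly independent, and
-- there are at most q(n,d) = Σ_{j ≥ d} C(n,j) of them.  Summation by parts gives
-- Σ |A(x)| ≤ q(n,0) + Σ_{k ≥ 0} 2ᵏ q(n,k+1) = Σ_j C(n,j) 2ʲ = 3ⁿ.
-- Dimensions are avoided: dim V ≥ d is expressed as 2ᵈ < 2 |V|.
module Submission where

open import Defs
open import Data.Bool.Base using (true; false; if_then_else_)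
open import Data.Fin.Base using (Fin; zero; suc)
open import Data.Fin.Properties using (injective⇒≤; *↔×)
open import Data.List.Base using (List; []; _∷_; map; _++_; filter; length)
open import Data.List.Membership.Propositional.Properties using (∈-map⁺; ∈-map⁻; ∈-++⁺ˡ; ∈-++⁺ʳ)
import Data.List.Membership.Propositional as List
open import Data.List.Properties using (filter-++; filter-none; length-filter; length-++; length-map)
open import Data.List.Relation.Unary.All as All using (All; []; _∷_)
open import Data.List.Relation.Unary.All.Properties using (all-filter)
open import Data.List.Relation.Unary.AllPairs using ([]; _∷_)
open import Data.List.Relation.Unary.Any as Any using (here; any?)
open import Data.List.Relation.Unary.Unique.Propositional using (Unique)
import Data.List.Relation.Unary.Unique.Propositional.Properties as Unique
open import Data.Nat.Base as ℕ using (ℕ; zero; suc; pred; _≤_; _<_; _^_; _*_; z≤n; s≤s)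
open import Data.Nat.ListAction using (sum)
open import Data.Nat.Properties as ℕ using (_<?_)
open import Data.Nat.Tactic.RingSolver using (solve-∀)
open import Data.Parity.Base as ℙ using (Parity; 0ℙ; 1ℙ)
import Data.Parity.Properties as ℙ
open import Data.Product.Base using (_×_; _,_; proj₁; proj₂; uncurry)
open import Data.Product.Function.NonDependent.Propositional using (_×-↔_)
open import Data.Sum.Base using (inj₁; inj₂)
open import Data.Unit.Base using (⊤)
open import Data.Vec.Base as Vec using ([]; _∷_)
import Data.Vec.Properties as Vec
open import Function.Base using (_∘_)
open import Function.Bundles using (_↔_; mk↔ₛ′; Injection; Inverse)
open import Function.Construct.Composition using (_↔-∘_)
open import Function.Construct.Symmetry using (↔-sym)
open import Function.Properties.Inverse using (↔⇒↣)
open import Level using (Level)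
open import Relation.Binary.PropositionalEquality
  using (_≡_; _≢_; _≗_; refl; sym; trans; cong; cong₂; subst; subst₂; module ≡-Reasoning)
open import Relation.Nullary using (¬_; Dec; yes; no; does; contradiction)
open import Relation.Nullary.Decidable using (map′; dec-true)
open import Relation.Unary using (Pred; Decidable; Satisfiable; _∪_)
open import Relation.Unary.Properties using (_∪?_)
import Algebra.Properties.CommutativeSemigroup as CommutativeSemigroup

private
  variable
    ℓ ℓ₁ ℓ₂ : Level
    n d : ℕ

-- Vector arithmetic in characteristic 2

+-assoc : (u v w : 𝔽₂^ n) → (u + v) + w ≡ u + (v + w)
+-assoc = Vec.zipWith-assoc ℙ.+-assoc

+-comm : (u v : 𝔽₂^ n) → u + v ≡ v + u
+-comm = Vec.zipWith-comm ℙ.+-comm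

+-identityˡ : (v : 𝔽₂^ n) → 𝟎 + v ≡ v
+-identityˡ = Vec.zipWith-identityˡ ℙ.+-identityˡ

+-identityʳ : (v : 𝔽₂^ n) → v + 𝟎 ≡ v
+-identityʳ = Vec.zipWith-identityʳ ℙ.+-identityʳ

+-self : (v : 𝔽₂^ n) → v + v ≡ 𝟎
+-self []      = refl
+-self (b ∷ v) = cong₂ _∷_ (ℙ.p+p≡0ℙ b) (+-self v)

+-cancel-self : (u v : 𝔽₂^ n) → u + (u + v) ≡ v
+-cancel-self u v = begin
  u + (u + v)  ≡⟨ +-assoc u u v ⟨
  (u + u) + v  ≡⟨ cong (_+ v) (+-self u) ⟩
  𝟎 + v        ≡⟨ +-identityˡ v ⟩
  v            ∎
  where open ≡-Reasoning

-- Counting vectors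

∈-vectors : (v : 𝔽₂^ n) → v List.∈ vectors n
∈-vectors []                   = here refl
∈-vectors (0ℙ ∷ v)             = ∈-++⁺ˡ (∈-map⁺ (0ℙ ∷_) (∈-vectors v))
∈-vectors {n = suc n} (1ℙ ∷ v) = ∈-++⁺ʳ (map (0ℙ ∷_) (vectors n)) (∈-map⁺ (1ℙ ∷_) (∈-vectors v))

vectors-unique : ∀ n → Unique (vectors n)
vectors-unique zero    = [] ∷ []
vectors-unique (suc n) =
  Unique.++⁺ (Unique.map⁺ Vec.∷-injectiveʳ (vectors-unique n))
             (Unique.map⁺ Vec.∷-injectiveʳ (vectors-unique n))
             λ (v∈₀ , v∈₁) → disjoint (proj₂ (proj₂ (∈-map⁻ (0ℙ ∷_) v∈₀))) (proj₂ (proj₂ (∈-map⁻ (1ℙ ∷_) v∈₁)))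
  where
  disjoint : ∀ {v : 𝔽₂^ (suc n)} {u u′ : 𝔽₂^ n} → v ≡ 0ℙ ∷ u → v ≢ 1ℙ ∷ u′
  disjoint refl ()

length-vectors : ∀ n → length (vectors n) ≡ 2 ^ n
length-vectors zero    = refl
length-vectors (suc n) = begin
  length (map (0ℙ ∷_) vs ++ map (1ℙ ∷_) vs)           ≡⟨ length-++ (map (0ℙ ∷_) vs) ⟩
  length (map (0ℙ ∷_) vs) ℕ.+ length (map (1ℙ ∷_) vs)
    ≡⟨ cong₂ ℕ._+_ (length-map (0ℙ ∷_) vs) (length-map (1ℙ ∷_) vs) ⟩
  length vs ℕ.+ length vs  ≡⟨ cong₂ ℕ._+_ (length-vectors n) (length-vectors n) ⟩
  2 ^ n ℕ.+ 2 ^ n          ≡⟨ cong (2 ^ n ℕ.+_) (ℕ.+-identityʳ (2 ^ n)) ⟨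
  2 ^ suc n                ∎
  where
  open ≡-Reasoning
  vs = vectors n

satisfiable? : {P : Pred (𝔽₂^ n) ℓ} → Decidable P → Dec (Satisfiable P)
satisfiable? {n = n} {P = P} P? =
  map′ Any.satisfied (λ (v , Pv) → Any.map (λ eq → subst P eq Pv) (∈-vectors v)) (any? P? (vectors n))

module _ {P : Pred (𝔽₂^ n) ℓ} (P? : Decidable P) where

  ¬satisfiable⇒card≡0 : ¬ Satisfiable P → card P? ≡ 0
  ¬satisfiable⇒card≡0 ¬sat = cong length (filter-none P? (All.universal (λ v Pv → ¬sat (v , Pv)) (vectors n)))

  card>0⇒satisfiable : 0 < card P? → Satisfiable P
  card>0⇒satisfiable card>0 with satisfiable? P?
  ... | yes sat = sat
  ... | no ¬sat = contradiction (¬satisfiable⇒card≡0 ¬sat) (ℕ.>⇒≢ card>0)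

  card≤2^n : card P? ≤ 2 ^ n
  card≤2^n = subst (card P? ≤_) (length-vectors n) (length-filter P? (vectors n))

length-filter-map : ∀ {a b} {A : Set a} {B : Set b} {P : Pred B ℓ} (P? : Decidable P) (f : A → B) xs →
                    length (filter P? (map f xs)) ≡ length (filter (P? ∘ f) xs)
length-filter-map P? f []       = refl
length-filter-map P? f (x ∷ xs) with does (P? (f x))
... | true  = cong suc (length-filter-map P? f xs)
... | false = length-filter-map P? f xs

card-suc : {P : Pred (𝔽₂^ (suc n)) ℓ} (P? : Decidable P) →
           card P? ≡ card (P? ∘ (0ℙ ∷_)) ℕ.+ card (P? ∘ (1ℙ ∷_))
card-suc {n = n} P? = begin
  length (filter P? (map (0ℙ ∷_) vs ++ map (1ℙ ∷_) vs))
    ≡⟨ cong length (filter-++ P? (map (0ℙ ∷_) vs) _) ⟩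
  length (filter P? (map (0ℙ ∷_) vs) ++ filter P? (map (1ℙ ∷_) vs))
    ≡⟨ length-++ (filter P? (map (0ℙ ∷_) vs)) ⟩
  length (filter P? (map (0ℙ ∷_) vs)) ℕ.+ length (filter P? (map (1ℙ ∷_) vs))
    ≡⟨ cong₂ ℕ._+_ (length-filter-map P? (0ℙ ∷_) vs) (length-filter-map P? (1ℙ ∷_) vs) ⟩
  card (P? ∘ (0ℙ ∷_)) ℕ.+ card (P? ∘ (1ℙ ∷_)) ∎
  where
  open ≡-Reasoning
  vs = vectors n

-- Induction on the coordinates: a leading `0ℙ` in the translation vector keeps the two halves of
-- the cube in place, a leading `1ℙ` swaps them. This is what compares the slices `V₁` and `V₀` of a
-- subspace below.
card-translate-≤ : ∀ {n} {P : Pred (𝔽₂^ n) ℓ₁} {Q : Pred (𝔽₂^ n) ℓ₂}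
                   (P? : Decidable P) (Q? : Decidable Q) (w : 𝔽₂^ n) →
                   (∀ v → P v → Q (w + v)) → card P? ≤ card Q?
card-translate-≤ P? Q? [] P⇒Q with P? [] | Q? []
... | no _   | _      = z≤n
... | yes _  | yes _  = ℕ.≤-refl
... | yes P[] | no ¬Q[] = contradiction (P⇒Q [] P[]) ¬Q[]
card-translate-≤ P? Q? (0ℙ ∷ w) P⇒Q =
  subst₂ _≤_ (sym (card-suc P?)) (sym (card-suc Q?))
    (ℕ.+-mono-≤ (card-translate-≤ _ _ w (P⇒Q ∘ (0ℙ ∷_))) (card-translate-≤ _ _ w (P⇒Q ∘ (1ℙ ∷_))))
card-translate-≤ P? Q? (1ℙ ∷ w) P⇒Q =
  subst₂ _≤_ (sym (card-suc P?)) (trans (ℕ.+-comm (card (Q? ∘ (1ℙ ∷_))) _) (sym (card-suc Q?)))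
    (ℕ.+-mono-≤ (card-translate-≤ _ _ w (P⇒Q ∘ (0ℙ ∷_))) (card-translate-≤ _ _ w (P⇒Q ∘ (1ℙ ∷_))))

length-filter-∪ : ∀ {a} {A : Set a} {P : Pred A ℓ₁} {Q : Pred A ℓ₂} (P? : Decidable P) (Q? : Decidable Q) →
                  (∀ v → P v → ¬ Q v) → ∀ xs →
                  length (filter (P? ∪? Q?) xs) ≡ length (filter P? xs) ℕ.+ length (filter Q? xs)
length-filter-∪ P? Q? disjoint []       = refl
length-filter-∪ P? Q? disjoint (x ∷ xs) with P? x | Q? x
... | yes Px | yes Qx = contradiction Qx (disjoint x Px)
... | yes _  | no _   = cong suc (length-filter-∪ P? Q? disjoint xs)
... | no _   | yes _  = trans (cong suc (length-filter-∪ P? Q? disjoint xs)) (sym (ℕ.+-suc _ _))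
... | no _   | no _   = length-filter-∪ P? Q? disjoint xs

-- Codegree

∂ : (𝔽₂^ (suc n) → Parity) → 𝔽₂^ n → Parity
∂ f y = f (0ℙ ∷ y) ℙ.+ f (1ℙ ∷ y)

-- Splitting off the first variable, f (b ∷ y) = f (0 ∷ y) + b · ∂ f y, so deg f ≤ n + 1 − d
-- means deg f (0 ∷ _) ≤ n − (d − 1) and deg (∂ f) ≤ n − d.
Codegree≥ : ∀ {n} → ℕ → (𝔽₂^ n → Parity) → Set
Codegree≥ {zero}  zero    f = ⊤
Codegree≥ {zero}  (suc d) f = f [] ≡ 0ℙ
Codegree≥ {suc n} d       f = Codegree≥ (pred d) (f ∘ (0ℙ ∷_)) × Codegree≥ d (∂ f)

codegree-resp : ∀ d {f g : 𝔽₂^ n → Parity} → f ≗ g → Codegree≥ d f → Codegree≥ d g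
codegree-resp {zero}  zero    f≗g _         = _
codegree-resp {zero}  (suc d) f≗g f≡0       = trans (sym (f≗g [])) f≡0
codegree-resp {suc n} d       f≗g (c₀ , c∂) =
  codegree-resp (pred d) (f≗g ∘ (0ℙ ∷_)) c₀ ,
  codegree-resp d (λ y → cong₂ ℙ._+_ (f≗g (0ℙ ∷ y)) (f≗g (1ℙ ∷ y))) c∂

codegree-0 : ∀ d → Codegree≥ {n} d (λ _ → 0ℙ)
codegree-0 {zero}  zero    = _
codegree-0 {zero}  (suc d) = refl
codegree-0 {suc n} d       = codegree-0 (pred d) , codegree-0 d

codegree-+ : ∀ d {f g : 𝔽₂^ n → Parity} → Codegree≥ d f → Codegree≥ d g →
             Codegree≥ d (λ y → f y ℙ.+ g y)
codegree-+ {zero}  zero    _         _           = _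
codegree-+ {zero}  (suc d) f≡0       g≡0         = cong₂ ℙ._+_ f≡0 g≡0
codegree-+ {suc n} d {f} {g} (c₀ , c∂) (c₀′ , c∂′) =
  codegree-+ (pred d) c₀ c₀′ ,
  codegree-resp d (λ y → interchange (f (0ℙ ∷ y)) (f (1ℙ ∷ y)) (g (0ℙ ∷ y)) (g (1ℙ ∷ y)))
    (codegree-+ d c∂ c∂′)
  where open CommutativeSemigroup ℙ.+-commutativeSemigroup using (interchange)

codegree-* : ∀ d c {f : 𝔽₂^ n → Parity} → Codegree≥ d f → Codegree≥ d (λ y → c ℙ.* f y)
codegree-* d 0ℙ _  = codegree-0 d
codegree-* d 1ℙ cf = cf

codegree-pred : ∀ d {f : 𝔽₂^ n → Parity} → Codegree≥ d f → Codegree≥ (pred d) f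
codegree-pred {zero}  zero          _         = _
codegree-pred {zero}  (suc zero)    _         = _
codegree-pred {zero}  (suc (suc d)) f≡0       = f≡0
codegree-pred {suc n} d             (c₀ , c∂) = codegree-pred (pred d) c₀ , codegree-pred d c∂

-- The tail sum of the binomials C(n, j) over j ≥ d, given by Pascal's rule. It is the number of
-- squarefree monomials of degree at most n - d. Since `pred 0` is 0, `q n 0` is 2ⁿ.
q : ℕ → ℕ → ℕ
q zero    zero    = 1
q zero    (suc d) = 0
q (suc n) d       = q n (pred d) ℕ.+ q n d

-- The coefficients of the multilinear polynomial of `f` at the monomials of degree at most n - d;
-- those of higher degree are left out.
coefficients : ∀ n d → (𝔽₂^ n → Parity) → 𝔽₂^ (q n d)
coefficients zero    zero    f = f [] ∷ []
coefficients zero    (suc d) f = []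
coefficients (suc n) d       f = coefficients n (pred d) (f ∘ (0ℙ ∷_)) Vec.++ coefficients n d (∂ f)

-- The coefficients left out vanish by the codegree bounds. In the recursion, `f (1ℙ ∷ y)` is
-- recovered from `f (0ℙ ∷ y)` and `∂ f y`.
coefficients-injective : ∀ n d {f g : 𝔽₂^ n → Parity} → Codegree≥ d f → Codegree≥ d g →
                         coefficients n d f ≡ coefficients n d g → f ≗ g
coefficients-injective zero zero _ _ eq [] = Vec.∷-injectiveˡ eq
coefficients-injective zero (suc d) f≡0 g≡0 _ [] = trans f≡0 (sym g≡0)
coefficients-injective (suc n) d {f} {g} (c₀ , c∂) (c₀′ , c∂′) eq = f≗g
  where
  eqs = Vec.++-injective (coefficients n (pred d) (f ∘ (0ℙ ∷_))) _ eq

  f≗g₀ : f ∘ (0ℙ ∷_) ≗ g ∘ (0ℙ ∷_)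
  f≗g₀ = coefficients-injective n (pred d) c₀ c₀′ (proj₁ eqs)

  f≗g : f ≗ g
  f≗g (0ℙ ∷ y) = f≗g₀ y
  f≗g (1ℙ ∷ y) = ℙ.+-cancelˡ-≡ (f (0ℙ ∷ y)) _ _
    (trans (coefficients-injective n d c∂ c∂′ (proj₂ eqs) y) (cong (ℙ._+ g (1ℙ ∷ y)) (sym (f≗g₀ y))))

-- Linear independence

Parity↔Fin2 : Parity ↔ Fin 2
Parity↔Fin2 = mk↔ₛ′ (λ { 0ℙ → zero ; 1ℙ → suc zero }) (λ { zero → 0ℙ ; (suc zero) → 1ℙ })
                    (λ { zero → refl ; (suc zero) → refl }) (λ { 0ℙ → refl ; 1ℙ → refl })

𝔽₂^↔Fin : ∀ n → 𝔽₂^ n ↔ Fin (2 ^ n)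
𝔽₂^↔Fin zero    = mk↔ₛ′ (λ _ → zero) (λ _ → []) (λ { zero → refl }) (λ { [] → refl })
𝔽₂^↔Fin (suc n) = ↔-sym (*↔× {2} {2 ^ n}) ↔-∘ ((Parity↔Fin2 ×-↔ 𝔽₂^↔Fin n) ↔-∘ uncons↔)
  where
  uncons↔ : 𝔽₂^ (suc n) ↔ (Parity × 𝔽₂^ n)
  uncons↔ = mk↔ₛ′ Vec.uncons (uncurry _∷_) (λ _ → refl) (λ { (_ ∷ _) → refl })

-- Cardinalities stand in for ranks: n < m would give 2ⁿ < 2ᵐ, against an injection of a set of size
-- 2ᵐ into one of size 2ⁿ.
injective⇒dim≤ : ∀ {m n} (g : 𝔽₂^ m → 𝔽₂^ n) → (∀ {u v} → g u ≡ g v → u ≡ v) → m ≤ n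
injective⇒dim≤ {m} {n} g g-inj = ℕ.≮⇒≥ λ n<m →
  ℕ.<⇒≱ (ℕ.^-monoʳ-< 2 (s≤s (s≤s z≤n)) n<m)
    (injective⇒≤ (Injection.injective (↔⇒↣ (↔-sym (𝔽₂^↔Fin m))) ∘ g-inj ∘ Injection.injective (↔⇒↣ (𝔽₂^↔Fin n))))

module _ (f : 𝔽₂^ n → 𝔽₂^ n → Parity) where

  combination : (xs : List (𝔽₂^ n)) → 𝔽₂^ (length xs) → 𝔽₂^ n → Parity
  combination []       []       y = 0ℙ
  combination (x ∷ xs) (c ∷ cs) y = c ℙ.* f x y ℙ.+ combination xs cs y

  combination-codegree : ∀ {xs} → All (Codegree≥ d ∘ f) xs → (cs : 𝔽₂^ (length xs)) → Codegree≥ d (combination xs cs)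
  combination-codegree {d} []         []       = codegree-0 d
  combination-codegree {d} (fx ∷ fxs) (c ∷ cs) =
    codegree-+ d (codegree-* d c fx) (combination-codegree fxs cs)

  combination-vanishes : ∀ {y xs} → All (λ x → f x y ≡ 0ℙ) xs → (cs : 𝔽₂^ (length xs)) → combination xs cs y ≡ 0ℙ
  combination-vanishes []           []       = refl
  combination-vanishes (fxy≡0 ∷ fs) (c ∷ cs) =
    cong₂ ℙ._+_ (trans (cong (c ℙ.*_) fxy≡0) (ℙ.*-zeroʳ c)) (combination-vanishes fs cs)

  module _ {S : Pred (𝔽₂^ n) ℓ} (f-diag : ∀ {x} → S x → f x x ≡ 1ℙ)
           (f-off : ∀ {x y} → S x → S y → x ≢ y → f x y ≡ 0ℙ) where

    -- On `S` the matrix `f x y` is the identity. Evaluating at the head `x` kills every other term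
    -- and reads off the coefficient of `f x`; cancelling that term leaves the tail.
    combination-injective : ∀ {xs} → All S xs → Unique xs → (cs cs′ : 𝔽₂^ (length xs)) →
                            combination xs cs ≗ combination xs cs′ → cs ≡ cs′
    combination-injective []        []             []       []         _  = refl
    combination-injective {x ∷ xs} (Sx ∷ Sxs) (x∉ ∷ unique) (c ∷ cs) (c′ ∷ cs′) eq =
      cong₂ _∷_ c≡c′ (combination-injective Sxs unique cs cs′ λ y →
        ℙ.+-cancelˡ-≡ (c ℙ.* f x y) _ _
          (trans (eq y) (cong (λ a → a ℙ.* f x y ℙ.+ combination xs cs′ y) (sym c≡c′))))
      where
      at-x : ∀ a (as : 𝔽₂^ (length xs)) → combination (x ∷ xs) (a ∷ as) x ≡ a
      at-x a as = begin
        a ℙ.* f x x ℙ.+ combination xs as x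
          ≡⟨ cong₂ (λ s t → a ℙ.* s ℙ.+ t) (f-diag Sx) (combination-vanishes off as) ⟩
        a ℙ.* 1ℙ ℙ.+ 0ℙ  ≡⟨ ℙ.+-identityʳ (a ℙ.* 1ℙ) ⟩
        a ℙ.* 1ℙ         ≡⟨ ℙ.*-identityʳ a ⟩
        a                ∎
        where
        open ≡-Reasoning
        off : All (λ z → f z x ≡ 0ℙ) xs
        off = All.zipWith (λ (x≢z , Sz) → f-off Sz Sx (x≢z ∘ sym)) (x∉ , Sxs)

      c≡c′ : c ≡ c′
      c≡c′ = trans (sym (at-x c cs)) (trans (eq x) (at-x c′ cs′))

    -- Distinct coefficient vectors give distinct combinations, all of codegree at least `d`, and
    -- these are told apart by their `q n d` polynomial coefficients.
    independent⇒length≤q : ∀ {xs} → All S xs → Unique xs → All (Codegree≥ d ∘ f) xs → length xs ≤ q n d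
    independent⇒length≤q {d} {xs} Sxs unique fxs =
      injective⇒dim≤ (coefficients n d ∘ combination xs) λ {cs} {cs′} eq →
        combination-injective Sxs unique cs cs′
          (coefficients-injective n d (combination-codegree fxs cs) (combination-codegree fxs cs′) eq)

-- Indicators of cosets

indicator : {P : Set ℓ} → Dec P → Parity
indicator P? = if does P? then 1ℙ else 0ℙ

indicator-true : {P : Set ℓ} (P? : Dec P) → P → indicator P? ≡ 1ℙ
indicator-true (yes _) _ = refl
indicator-true (no ¬p) p = contradiction p ¬p

indicator-false : {P : Set ℓ} (P? : Dec P) → ¬ P → indicator P? ≡ 0ℙ
indicator-false (yes p) ¬p = contradiction p ¬p
indicator-false (no _)  _  = refl

indicator-cong : {P : Set ℓ₁} {Q : Set ℓ₂} (P? : Dec P) (Q? : Dec Q) →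
                 (P → Q) → (Q → P) → indicator P? ≡ indicator Q?
indicator-cong (yes p) Q? P⇒Q _   = sym (indicator-true Q? (P⇒Q p))
indicator-cong (no ¬p) Q? _   Q⇒P = sym (indicator-false Q? (¬p ∘ Q⇒P))

-- Passing to a subspace of at least half the size costs at most one dimension. For `d` = 0 the
-- truncated `pred` asks only that `c` be positive.
2^pred< : ∀ d c → 2 ^ d < 2 * (2 * c) → 2 ^ pred d < 2 * c
2^pred< zero    (suc c) _  = s≤s (subst (1 ≤_) (sym (ℕ.+-suc c (c ℕ.+ 0))) (s≤s z≤n))
2^pred< (suc d) c       lt = ℕ.*-cancelˡ-< 2 (2 ^ d) (2 * c) lt

-- Induction on n, cutting `V` by its first coordinate. The slice `V₀` is a subspace and `V₁` is
-- empty or a coset of it. The derivative is then, up to translation by `x`, the indicator of `V₀`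
-- if `V₁` is empty, zero if the slices coincide, and the indicator of the subspace `V₀ ∪ V₁` if
-- they are disjoint.
coset-codegree : ∀ {n} d {V : Pred (𝔽₂^ n) ℓ} (V? : Decidable V) → IsSubspace V → 2 ^ d < 2 * card V? →
                 ∀ x → Codegree≥ d (λ y → indicator (V? (x + y)))
coset-codegree {n = zero} zero    V? V-sub size []  = _
coset-codegree {n = zero} (suc d) V? V-sub size [] = contradiction size (ℕ.≤⇒≯ (begin
  2 * card V?  ≤⟨ ℕ.*-monoʳ-≤ 2 (card≤2^n V?) ⟩
  2 * 1        ≤⟨ ℕ.*-monoʳ-≤ 2 (ℕ.m^n>0 2 d) ⟩
  2 * 2 ^ d    ∎))
  where open ℕ.≤-Reasoning
coset-codegree {ℓ} {n = suc n} d {V} V? V-sub size (b ∷ x) = assemble b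
  where
  open IsSubspace V-sub

  V₀ V₁ : Pred (𝔽₂^ n) ℓ
  V₀ v = V (0ℙ ∷ v)
  V₁ v = V (1ℙ ∷ v)

  V₀? : Decidable V₀
  V₀? v = V? (0ℙ ∷ v)

  V₁? : Decidable V₁
  V₁? v = V? (1ℙ ∷ v)

  V₀-sub : IsSubspace V₀
  V₀-sub = record
    { 𝟎∈       = 𝟎∈
    ; +-closed = +-closed
    ; ·-closed = λ c {v} Vv → subst (λ a → V (a ∷ c · v)) (ℙ.*-zeroʳ c) (·-closed c Vv)
    }

  g₀ g₁ : 𝔽₂^ n → Parity
  g₀ y = indicator (V₀? (x + y))
  g₁ y = indicator (V₁? (x + y))

  -- The bit `b` only decides which of `g₀` and `g₁` is the restriction to first coordinate 0; the
  -- derivative is their sum either way. Treating all three functions together serves both values of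
  -- `b`.
  slices : Codegree≥ (pred d) g₀ × Codegree≥ (pred d) g₁ × Codegree≥ d (λ y → g₀ y ℙ.+ g₁ y)
  slices with satisfiable? V₁?
  -- Here `V₀` is as large as `V`, so `g₀` has the full codegree `d`.
  ... | no ¬V₁ =
    codegree-pred d c₀ ,
    codegree-resp (pred d) (sym ∘ g₁≡0) (codegree-0 (pred d)) ,
    codegree-resp d (λ y → sym (trans (cong (g₀ y ℙ.+_) (g₁≡0 y)) (ℙ.+-identityʳ (g₀ y)))) c₀
    where
    g₁≡0 : ∀ y → g₁ y ≡ 0ℙ
    g₁≡0 y = indicator-false (V₁? (x + y)) (λ v → ¬V₁ (_ , v))

    card≡ : card V? ≡ card V₀?
    card≡ = trans (card-suc V?) (trans (cong (card V₀? ℕ.+_) (¬satisfiable⇒card≡0 V₁? ¬V₁)) (ℕ.+-identityʳ _))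

    c₀ : Codegree≥ d g₀
    c₀ = coset-codegree d V₀? V₀-sub (subst (λ k → 2 ^ d < 2 * k) card≡ size) x
  -- Translation by `w` exchanges `V₀` and `V₁`. So `V₀` has at least half the size of `V`, and `g₁`
  -- is the indicator of the coset of `V₀` through `w + x`.
  ... | yes (w , w∈V₁) =
    coset-codegree (pred d) V₀? V₀-sub size₀ x ,
    codegree-resp (pred d) (sym ∘ g₁≡) (coset-codegree (pred d) V₀? V₀-sub size₀ (w + x)) ,
    c-sum
    where
    V₁⇒V₀ : ∀ v → V₁ v → V₀ (w + v)
    V₁⇒V₀ v = +-closed w∈V₁

    V₀⇒V₁ : ∀ v → V₀ (w + v) → V₁ v
    V₀⇒V₁ v Vwv = subst V₁ (+-cancel-self w v) (+-closed w∈V₁ Vwv)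

    card≤ : card V? ≤ 2 * card V₀?
    card≤ = begin
      card V?                   ≡⟨ card-suc V? ⟩
      card V₀? ℕ.+ card V₁?     ≤⟨ ℕ.+-monoʳ-≤ (card V₀?) (card-translate-≤ V₁? V₀? w V₁⇒V₀) ⟩
      card V₀? ℕ.+ card V₀?     ≡⟨ cong (card V₀? ℕ.+_) (ℕ.+-identityʳ _) ⟨
      2 * card V₀?              ∎
      where open ℕ.≤-Reasoning

    size₀ : 2 ^ pred d < 2 * card V₀?
    size₀ = 2^pred< d (card V₀?) (ℕ.<-≤-trans size (ℕ.*-monoʳ-≤ 2 card≤))

    g₁≡ : ∀ y → g₁ y ≡ indicator (V₀? ((w + x) + y))
    g₁≡ y = indicator-cong (V₁? (x + y)) (V₀? ((w + x) + y))
      (subst V₀ (sym (+-assoc w x y)) ∘ V₁⇒V₀ (x + y))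
      (V₀⇒V₁ (x + y) ∘ subst V₀ (+-assoc w x y))

    c-sum : Codegree≥ d (λ y → g₀ y ℙ.+ g₁ y)
    c-sum with V₀? w
    -- Adding `0ℙ ∷ w` to `1ℙ ∷ w` puts `1ℙ ∷ 𝟎` into `V`. Hence `V₁` equals `V₀` and the sum
    -- cancels.
    ... | yes w∈V₀ = codegree-resp d (λ y → sym (trans (cong (g₀ y ℙ.+_) (g₁≡g₀ y)) (ℙ.p+p≡0ℙ (g₀ y)))) (codegree-0 d)
      where
      𝟎∈V₁ : V₁ 𝟎
      𝟎∈V₁ = subst V₁ (+-self w) (+-closed w∈V₁ w∈V₀)

      g₁≡g₀ : ∀ y → g₁ y ≡ g₀ y
      g₁≡g₀ y = indicator-cong (V₁? (x + y)) (V₀? (x + y))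
        (subst V₀ (+-identityˡ (x + y)) ∘ +-closed 𝟎∈V₁)
        (subst V₁ (+-identityˡ (x + y)) ∘ +-closed 𝟎∈V₁)
    ... | no w∉V₀ =
      -- Deleting the first coordinate maps V bijectively onto V₀ ∪ V₁.
      codegree-resp d sum≡
        (coset-codegree d (V₀? ∪? V₁?) V₀∪V₁-sub (subst (λ k → 2 ^ d < 2 * k) card≡ size) x)
      where
      -- A common element `v` would put `(w + v) + v`, which is `w`, into `V₀`.
      disjoint : ∀ v → V₀ v → ¬ V₁ v
      disjoint v v∈V₀ v∈V₁ =
        w∉V₀ (subst V₀ (trans (+-comm (w + v) v) (trans (cong (v +_) (+-comm w v)) (+-cancel-self v w)))
                (+-closed (V₁⇒V₀ v v∈V₁) v∈V₀))

      V₀∪V₁-sub : IsSubspace (V₀ ∪ V₁)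
      V₀∪V₁-sub = record
        { 𝟎∈       = inj₁ 𝟎∈
        ; +-closed = λ where
            (inj₁ u) (inj₁ v) → inj₁ (+-closed u v)
            (inj₁ u) (inj₂ v) → inj₂ (+-closed u v)
            (inj₂ u) (inj₁ v) → inj₂ (+-closed u v)
            (inj₂ u) (inj₂ v) → inj₁ (+-closed u v)
        ; ·-closed = λ where
            c  (inj₁ v) → inj₁ (IsSubspace.·-closed V₀-sub c v)
            0ℙ (inj₂ v) → inj₁ (·-closed 0ℙ v)
            1ℙ (inj₂ v) → inj₂ (·-closed 1ℙ v)
        }

      card≡ : card V? ≡ card (V₀? ∪? V₁?)
      card≡ = trans (card-suc V?) (sym (length-filter-∪ V₀? V₁? disjoint (vectors n)))

      sum≡ : ∀ y → indicator ((V₀? ∪? V₁?) (x + y)) ≡ g₀ y ℙ.+ g₁ y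
      sum≡ y with V₀? (x + y) | V₁? (x + y)
      ... | yes p | yes p′ = contradiction p′ (disjoint _ p)
      ... | yes _ | no _   = refl
      ... | no _  | yes _  = refl
      ... | no _  | no _   = refl

  assemble : ∀ b → Codegree≥ d (λ y → indicator (V? ((b ∷ x) + y)))
  assemble 0ℙ = proj₁ slices , proj₂ (proj₂ slices)
  assemble 1ℙ = proj₁ (proj₂ slices) , codegree-resp d (λ y → ℙ.+-comm (g₀ y) (g₁ y)) (proj₂ (proj₂ slices))

-- Summation by parts

-- The Abel sum N(0) + Σ 2ᵏ N(k+1) over k < K. If N(d) counts the subspaces of dimension at least d
-- in a family of dimensions at most K, this is the sum of their sizes.
layers : (ℕ → ℕ) → ℕ → ℕ
layers N zero    = N zero
layers N (suc K) = layers N K ℕ.+ 2 ^ K * N (suc K)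

layers-mono : ∀ {M N} → (∀ d → M d ≤ N d) → ∀ K → layers M K ≤ layers N K
layers-mono M≤N zero    = M≤N zero
layers-mono M≤N (suc K) = ℕ.+-mono-≤ (layers-mono M≤N K) (ℕ.*-monoʳ-≤ (2 ^ K) (M≤N (suc K)))

layers-+ : ∀ M N K → layers (λ d → M d ℕ.+ N d) K ≡ layers M K ℕ.+ layers N K
layers-+ M N zero    = refl
layers-+ M N (suc K) = trans (cong (ℕ._+ 2 ^ K * (M (suc K) ℕ.+ N (suc K))) (layers-+ M N K))
  (rearrange (layers M K) (layers N K) (2 ^ K) (M (suc K)) (N (suc K)))
  where
  rearrange : ∀ a b p s t → (a ℕ.+ b) ℕ.+ p * (s ℕ.+ t) ≡ (a ℕ.+ p * s) ℕ.+ (b ℕ.+ p * t)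
  rearrange = solve-∀

-- Shifting by `pred` repeats the value at 0 and doubles the weight of every later one.
layers-pred : ∀ N K → layers (N ∘ pred) (suc K) ≡ 2 * layers N K
layers-pred N zero    = refl
layers-pred N (suc K) = trans (cong (ℕ._+ 2 ^ suc K * N (suc K)) (layers-pred N K))
  (rearrange (layers N K) (2 ^ K) (N (suc K)))
  where
  rearrange : ∀ a p s → 2 * a ℕ.+ 2 * p * s ≡ 2 * (a ℕ.+ p * s)
  rearrange = solve-∀

-- Pascal's rule splits the sum into a shifted part, at most twice the sum for n, and an unshifted
-- part, once that sum: a factor 3 in all.
layers-q≤3^n : ∀ n K → layers (q n) K ≤ 3 ^ n
layers-q≤3^n zero    zero    = ℕ.≤-refl
layers-q≤3^n zero    (suc K) =
  subst (_≤ 1) (sym (trans (cong (layers (q 0) K ℕ.+_) (ℕ.*-zeroʳ (2 ^ K))) (ℕ.+-identityʳ _))) (layers-q≤3^n zero K)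
layers-q≤3^n (suc n) K       = begin
  layers (q (suc n)) K                          ≡⟨ layers-+ (q n ∘ pred) (q n) K ⟩
  -- The extra layer only enlarges the sum and makes the index fit `layers-pred`.
  layers (q n ∘ pred) K ℕ.+ layers (q n) K      ≤⟨ ℕ.+-monoˡ-≤ _ (ℕ.m≤m+n (layers (q n ∘ pred) K) _) ⟩
  layers (q n ∘ pred) (suc K) ℕ.+ layers (q n) K ≡⟨ cong (ℕ._+ layers (q n) K) (layers-pred (q n) K) ⟩
  2 * layers (q n) K ℕ.+ layers (q n) K         ≡⟨ ℕ.+-comm (2 * layers (q n) K) _ ⟩
  3 * layers (q n) K                            ≤⟨ ℕ.*-monoʳ-≤ 3 (layers-q≤3^n n K) ⟩
  3 ^ suc n                                     ∎
  where open ℕ.≤-Reasoning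

height : ℕ → ℕ → ℕ
height c d = if does (2 ^ d <? 2 * c) then 1 else 0

height≡1 : ∀ c d → 2 ^ d < 2 * c → height c d ≡ 1
height≡1 c d lt = cong (if_then 1 else 0) (dec-true (2 ^ d <? 2 * c) lt)

-- For positive `c`, the layers add up to `c` rounded up to a power of two, capped at 2ᴷ. The strict
-- test 2ᵈ < 2c is what makes this round up, so `c` may be any number. Keeping `m` apart from `c`
-- lets the induction be applied to `m` = 2ᴷ when 2ᴷ < `c`; the top layer then adds another 2ᴷ.
≤layers-height : ∀ c K {m} → m ≤ c → m ≤ 2 ^ K → m ≤ layers (height c) K
≤layers-height zero    zero    m≤0 _   = ℕ.≤-trans m≤0 z≤n
≤layers-height (suc c) zero    _   m≤1 =
  subst (_ ≤_) (sym (height≡1 (suc c) 0 (ℕ.*-monoʳ-≤ 2 (s≤s z≤n)))) m≤1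
≤layers-height c       (suc K) {m} m≤c m≤2^ with 2 ^ K <? c
... | no ≮c  = ℕ.≤-trans (≤layers-height c K m≤c (ℕ.≤-trans m≤c (ℕ.≮⇒≥ ≮c))) (ℕ.m≤m+n _ _)
... | yes <c = begin
  m                                                 ≤⟨ m≤2^ ⟩
  2 ^ K ℕ.+ (2 ^ K ℕ.+ 0)                           ≡⟨ cong (2 ^ K ℕ.+_) (trans (ℕ.+-identityʳ _) (sym (ℕ.*-identityʳ _))) ⟩
  2 ^ K ℕ.+ 2 ^ K * 1
    ≤⟨ ℕ.+-mono-≤ (≤layers-height c K (ℕ.<⇒≤ <c) ℕ.≤-refl)
                  (ℕ.≤-reflexive (cong (2 ^ K *_) (sym (height≡1 c (suc K) (ℕ.*-monoʳ-< 2 <c))))) ⟩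
  layers (height c) K ℕ.+ 2 ^ K * height c (suc K)  ∎
  where open ℕ.≤-Reasoning

module _ {a} {A : Set a} (c : A → ℕ) where

  large? : ∀ d → Decidable (λ x → 2 ^ d < 2 * c x)
  large? d x = 2 ^ d <? 2 * c x

  -- Each term is bounded by its own layers; exchanging the sums turns the heights at level `d` into
  -- the number of large terms.
  sum≤layers : ∀ K → (∀ x → c x ≤ 2 ^ K) → ∀ xs →
               sum (map c xs) ≤ layers (λ d → length (filter (large? d) xs)) K
  sum≤layers K c≤ []       = z≤n
  sum≤layers K c≤ (x ∷ xs) = begin
    c x ℕ.+ sum (map c xs)
      ≤⟨ ℕ.+-mono-≤ (≤layers-height (c x) K ℕ.≤-refl (c≤ x)) (sum≤layers K c≤ xs) ⟩
    layers (height (c x)) K ℕ.+ layers (λ d → length (filter (large? d) xs)) K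
      ≡⟨ layers-+ (height (c x)) _ K ⟨
    layers (λ d → height (c x) d ℕ.+ length (filter (large? d) xs)) K
      ≤⟨ layers-mono (λ d → ℕ.≤-reflexive (sym (length-filter-∷ d))) K ⟩
    layers (λ d → length (filter (large? d) (x ∷ xs))) K ∎
    where
    open ℕ.≤-Reasoning
    length-filter-∷ : ∀ d → length (filter (large? d) (x ∷ xs)) ≡ height (c x) d ℕ.+ length (filter (large? d) xs)
    length-filter-∷ d with does (large? d x)
    ... | true  = refl
    ... | false = refl

theorem3p17 : ∀ {ℓ : Level} (n : ℕ) → 1 ≤ n →
    (A : 𝔽₂^ n → Pred (𝔽₂^ n) ℓ) (A? : ∀ x → Decidable (A x)) →
    Property* A →
    (∀ x → Satisfiable (A x) → IsSubspace (A x)) →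
    ∑ (λ x → card (A? x)) ≤ 3 ^ n
theorem3p17 n _ A A? property* subspace = begin
  ∑ (λ x → card (A? x))                                  ≤⟨ sum≤layers c n (λ x → card≤2^n (A? x)) (vectors n) ⟩
  layers (λ d → length (filter (large? c d) (vectors n))) n  ≤⟨ layers-mono large≤q n ⟩
  layers (q n) n                                         ≤⟨ layers-q≤3^n n n ⟩
  3 ^ n                                                  ∎
  where
  open ℕ.≤-Reasoning

  c : 𝔽₂^ n → ℕ
  c x = card (A? x)

  -- The indicator of x + A(x): in characteristic 2, y lies in it exactly when x + y lies in A(x).
  coset : 𝔽₂^ n → 𝔽₂^ n → Parity
  coset x y = indicator (A? x (x + y))

  coset-diag : ∀ {x} → Satisfiable (A x) → coset x x ≡ 1ℙ
  coset-diag {x} sat = indicator-true (A? x (x + x))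
    (subst (A x) (sym (+-self x)) (IsSubspace.𝟎∈ (subspace x sat)))

  -- If x + y were in A(x), it would be the sum of the distinct elements x + y and 𝟎 of A(x). Then y
  -- would lie in x + (A(x) +̂ A(x)), and property (*) would make A(y) empty.
  coset-off : ∀ {x y} → Satisfiable (A x) → Satisfiable (A y) → x ≢ y → coset x y ≡ 0ℙ
  coset-off {x} {y} satx (v , v∈Ay) x≢y = indicator-false (A? x (x + y)) λ x+y∈Ax →
    property* x y
      (x + y , (x + y , 𝟎 , x+y∈Ax , IsSubspace.𝟎∈ (subspace x satx) , x+y≢𝟎 , sym (+-identityʳ (x + y)))
             , sym (+-cancel-self x y))
      v v∈Ay
    where
    x+y≢𝟎 : x + y ≢ 𝟎
    x+y≢𝟎 eq = x≢y (trans (sym (+-identityʳ x)) (trans (cong (x +_) (sym eq)) (+-cancel-self x y)))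

  large⇒satisfiable : ∀ {d} x → 2 ^ d < 2 * c x → Satisfiable (A x)
  large⇒satisfiable x lt = card>0⇒satisfiable (A? x) (ℕ.*-cancelˡ-< 2 0 (c x) (ℕ.≤-<-trans z≤n lt))

  large≤q : ∀ d → length (filter (large? c d) (vectors n)) ≤ q n d
  large≤q d = independent⇒length≤q coset coset-diag coset-off
    (All.map (large⇒satisfiable {d} _) large)
    (Unique.filter⁺ (large? c d) (vectors-unique n))
    (All.map (λ {x} lt → coset-codegree d (A? x) (subspace x (large⇒satisfiable {d} x lt)) lt x) large)
    where
    large = all-filter (large? c d) (vectors n)
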